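{- Let $P_n$ denote the path on $n$ vertices and let $n \ge 6$. If $n \equiv 0 \pmod 5$ or $n \equiv 4 \pmod 5$, then $$\iota_{\rm g}(P_n)=\left\lceil\frac{2n}{5}\right\rceil-1 \qquad\text{and}\qquad \iota_{\rm g}'(P_n)=\left\lfloor\frac{2n+2}{5}\right\rfloor.$$
   Context: For a graph $G$ and $X\subseteq V(G)$, $N_G[X]$ denotes the set of vertices in $X$ or adjacent to a vertex of $X$. The isolation game on a finite graph $G$ is played by two players, Dominator and Staller, who alternately select vertices of $G$. If $X$ is the set of vertices selected so far, a vertex $x$ may be selected (is playable) only if $x$ dominates (i.e., equals or is adjacent to) some vertex belonging to a component of $G - N_G[X]$ with at least two vertices. The game ends when no playable vertex exists. Dominator aims to minimize the total number of selected vertices, Staller aims to maximize it. The game isolation number $\iota_{\rm g}(G)$ is the number of vertices selected when Dominator makes the first move and both play optimally; $\iota_{\rm g}'(G)$ is the same quantity when Staller makes the first move. -}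

module Defs where

open import Data.Nat using (ℕ; zero; suc; _+_; _⊓_; _⊔_; _≡ᵇ_)
open import Data.Bool using (Bool; true; false; _∧_; _∨_; not; T)
open import Data.Fin using (Fin; toℕ)
open import Data.List using (List; []; _∷_; map; foldr)
open import Data.Bool.ListAction using (any)
open import Data.List using (allFin) public
open import Relation.Binary.PropositionalEquality using (_≡_)

record Graph : Set where
  field
    n     : ℕ
    adj   : Fin n → Fin n → Bool
    sym   : ∀ x y → adj x y ≡ adj y x
    irrfl : ∀ x → adj x x ≡ false
open Graph public

pathAdj : (n : ℕ) → Fin n → Fin n → Bool
pathAdj n i j = (suc (toℕ i) ≡ᵇ toℕ j) ∨ (suc (toℕ j) ≡ᵇ toℕ i)

private
  ∨-comm : ∀ a b → (a ∨ b) ≡ (b ∨ a)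
  ∨-comm false false = _≡_.refl
  ∨-comm false true = _≡_.refl
  ∨-comm true false = _≡_.refl
  ∨-comm true true = _≡_.refl

  suc≢ : ∀ m → (suc m ≡ᵇ m) ≡ false
  suc≢ zero = _≡_.refl
  suc≢ (suc m) = suc≢ m

P : ℕ → Graph
P n = record
  { n = n
  ; adj = pathAdj n
  ; sym = λ x y → ∨-comm (suc (toℕ x) ≡ᵇ toℕ y) (suc (toℕ y) ≡ᵇ toℕ x)
  ; irrfl = λ x → irr x
  }
  where
  irr : ∀ x → pathAdj n x x ≡ false
  irr x with suc (toℕ x) ≡ᵇ toℕ x | suc≢ (toℕ x)
  ... | false | _ = _≡_.refl

module Game (G : Graph) where
  V : Set
  V = Fin (n G)

  eqV : V → V → Bool
  eqV x y = toℕ x ≡ᵇ toℕ y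

  dominates : V → V → Bool
  dominates x v = eqV x v ∨ adj G x v

  inN : List V → V → Bool
  inN X v = any (λ y → dominates y v) X

  -- v is a vertex of G - N_G[X] lying in a component with ≥ 2 vertices,
  -- i.e. v ∉ N[X] and v has a neighbour w ∉ N[X].
  inBigComp : List V → V → Bool
  inBigComp X v = not (inN X v) ∧ any (λ w → adj G v w ∧ not (inN X w)) (allFin (n G))

  playable : List V → V → Bool
  playable X x = any (λ v → dominates x v ∧ inBigComp X v) (allFin (n G))

  playableList : List V → List V
  playableList X = go (allFin (n G))
    where
    go : List V → List V
    go [] = []
    go (x ∷ xs) with playable X x
    ... | true = x ∷ go xs
    ... | false = go xs

  data Player : Set where
    Dominator Staller : Player

  other : Player → Player
  other Dominator = Staller
  other Staller = Dominator

  best : Player → ℕ → List ℕ → ℕ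
  best Dominator a as = foldr _⊓_ a as
  best Staller   a as = foldr _⊔_ a as

  -- Number of further vertices selected under optimal play, with player p
  -- to move after X has been selected.  The fuel k bounds the game length;
  -- every playable vertex is a new vertex, so the game has at most n moves
  -- and fuel n+1 is always sufficient.
  value : ℕ → Player → List V → ℕ
  value zero p X = 0
  value (suc k) p X = step (playableList X)
    where
    step : List V → ℕ
    step [] = 0
    step (x ∷ xs) = suc (best p (value k (other p) (x ∷ X))
                                (map (λ y → value k (other p) (y ∷ X)) xs))

ιg : Graph → ℕ
ιg G = Game.value G (suc (n G)) Game.Dominator []

ιg′ : Graph → ℕ
ιg′ G = Game.value G (suc (n G)) Game.Staller []

{-# OPTIONS --safe #-}

-- To a maximal run of undominated vertices of length m attach the weight w(m) with
-- w(0) = w(1) = 0, w(2), …, w(6) = 8, 12, 14, 15, 16 and w(m + 5) = w(m) + 16, and let W be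
-- the total weight of a position. The position is worth ⌊W/8⌋ if Dominator is to move and,
-- once a vertex has been selected, ⌈W/8⌉ if Staller is to move. Every move lowers W by at
-- least 1 and at most 15, which bounds what an arbitrary move of the opponent achieves.
-- Conversely, let g(m) ∈ {1, 2, 4, 8} be the largest power of two ≤ 8 dividing w(m). In a
-- run with the least g in the position, so that g divides W, Dominator can lower W by 16 − g
-- and Staller by g; divisibility absorbs the rounding. When g < 8, Staller plays a dominated
-- vertex next to the run; on the untouched path there is none and she opens at an end vertex
-- instead. For n = 5k and n = 5k − 1 the initial weight is 16k − 1 and 16k − 2.
-- The weights come from treating each run as a hot game: w(m)/8 is its mean value and
-- 1 − g(m)/8 its temperature.

module Submission where

open import Defs hiding (sym)
open import Algebra.Lattice.Properties.BooleanAlgebra as BooleanAlgebraProperties using ()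
open import Data.Bool using (Bool; true; false; _∧_; _∨_; not)
open import Data.Bool.ListAction using (any)
open import Data.Bool.Properties using (∧-zeroʳ; ∨-zeroʳ; T-≡; not-injective; ∨-∧-booleanAlgebra)
open import Data.Fin using (Fin; toℕ; zero; suc; fromℕ<)
open import Data.Fin.Properties using (toℕ<n; toℕ-fromℕ<)
open import Data.List using (List; []; _∷_; _++_; map; foldr; filterᵇ; length; replicate; tabulate; InitLast; initLast; _∷ʳ′_)
open import Data.List.Extrema.Nat using (argmin; argmin-sel; f[argmin]≤f[xs])
open import Data.List.Membership.Propositional using (_∈_)
open import Data.List.Membership.Propositional.Properties using (∈-allFin; ∈-∃++)
open import Data.List.Properties using (++-assoc; length-++; length-replicate; length-tabulate)
open import Data.List.Relation.Unary.All as All using ()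
open import Data.List.Relation.Unary.Any using (here; there)
open import Data.Nat using (ℕ; zero; suc; _+_; _*_; _∸_; _≤_; _<_; z≤n; s≤s; s≤s⁻¹; _⊓_; _⊔_; _≡ᵇ_; _≤?_; _<?_; NonZero)
open import Data.Nat.DivMod using (_/_; _%_; /-monoˡ-≤; m*n/n≡m; m/n*n≤m; m<n*o⇒m/o<n; m≡m%n+[m/n]*n)
open import Data.Nat.Divisibility using (_∣_; _∣?_; divides; _∣0; ∣-refl; ∣-trans; ∣m∣n⇒∣m+n; ∣m+n∣m⇒∣n; ∣m⇒∣m*n)
open import Data.Nat.ListAction using (sum)
open import Data.Nat.Properties
open import Data.Nat.Tactic.RingSolver using (solve-∀)
open import Data.Product using (_×_; _,_; proj₁; proj₂; ∃₂; ∃-syntax)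
open import Data.Sum using (_⊎_; inj₁; inj₂)
open import Function using (_∘_; Equivalence)
open import Relation.Binary.PropositionalEquality using (_≡_; refl; sym; trans; cong; cong₂; subst; subst₂; module ≡-Reasoning)
open import Relation.Nullary using (Dec; yes; no; ¬_; contradiction)
open import Relation.Nullary.Decidable using (from-yes; _×-dec_)

open BooleanAlgebraProperties ∨-∧-booleanAlgebra using (deMorgan₂)

-- Bounds on game values

foldr-⊓-≤ : ∀ {A : Set} (f : A → ℕ) {x y} xs → y ∈ x ∷ xs → foldr _⊓_ (f x) (map f xs) ≤ f y
foldr-⊓-≤ f [] (here refl) = ≤-refl
foldr-⊓-≤ f (z ∷ xs) (here refl) = ≤-trans (m⊓n≤n (f z) _) (foldr-⊓-≤ f xs (here refl))
foldr-⊓-≤ f (z ∷ xs) (there (here refl)) = m⊓n≤m (f z) _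
foldr-⊓-≤ f (z ∷ xs) (there (there p)) = ≤-trans (m⊓n≤n (f z) _) (foldr-⊓-≤ f xs (there p))

foldr-⊓-glb : ∀ {A : Set} (f : A → ℕ) {b x} xs → (∀ {y} → y ∈ x ∷ xs → b ≤ f y) →
  b ≤ foldr _⊓_ (f x) (map f xs)
foldr-⊓-glb f [] h = h (here refl)
foldr-⊓-glb f (z ∷ xs) h = ⊓-glb (h (there (here refl)))
  (foldr-⊓-glb f xs λ { (here p) → h (here p) ; (there p) → h (there (there p)) })

foldr-⊔-≥ : ∀ {A : Set} (f : A → ℕ) {x y} xs → y ∈ x ∷ xs → f y ≤ foldr _⊔_ (f x) (map f xs)
foldr-⊔-≥ f [] (here refl) = ≤-refl
foldr-⊔-≥ f (z ∷ xs) (here refl) = ≤-trans (foldr-⊔-≥ f xs (here refl)) (m≤n⊔m (f z) _)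
foldr-⊔-≥ f (z ∷ xs) (there (here refl)) = m≤m⊔n (f z) _
foldr-⊔-≥ f (z ∷ xs) (there (there p)) = ≤-trans (foldr-⊔-≥ f xs (there p)) (m≤n⊔m (f z) _)

foldr-⊔-lub : ∀ {A : Set} (f : A → ℕ) {b x} xs → (∀ {y} → y ∈ x ∷ xs → f y ≤ b) →
  foldr _⊔_ (f x) (map f xs) ≤ b
foldr-⊔-lub f [] h = h (here refl)
foldr-⊔-lub f (z ∷ xs) h = ⊔-lub (h (there (here refl)))
  (foldr-⊔-lub f xs λ { (here p) → h (here p) ; (there p) → h (there (there p)) })

any-intro : ∀ {A : Set} (p : A → Bool) {x} xs → x ∈ xs → p x ≡ true → any p xs ≡ true
any-intro p (x ∷ xs) (here refl) e rewrite e = refl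
any-intro p (y ∷ xs) (there i) e with p y
... | true = refl
... | false = any-intro p xs i e

any-elim : ∀ {A : Set} (p : A → Bool) xs → any p xs ≡ true → ∃[ x ] p x ≡ true
any-elim p (x ∷ xs) e with p x in eq
... | true = x , eq
... | false = any-elim p xs e

filterᵇ-∈ : ∀ {A : Set} (p : A → Bool) {x} xs → x ∈ xs → p x ≡ true → x ∈ filterᵇ p xs
filterᵇ-∈ p (x ∷ xs) (here refl) e rewrite e = here refl
filterᵇ-∈ p (y ∷ xs) (there i) e with p y
... | true = there (filterᵇ-∈ p xs i e)
... | false = filterᵇ-∈ p xs i e

∈-filterᵇ : ∀ {A : Set} (p : A → Bool) {x} xs → x ∈ filterᵇ p xs → p x ≡ true
∈-filterᵇ p (y ∷ xs) i with p y in eq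
∈-filterᵇ p (y ∷ xs) (here refl) | true = eq
∈-filterᵇ p (y ∷ xs) (there i) | true = ∈-filterᵇ p xs i
∈-filterᵇ p (y ∷ xs) i | false = ∈-filterᵇ p xs i

module GameProperties (G : Graph) where
  open Game G

  mutual
    -- A name for the local function of `playableList`: the metavariable is
    -- solved by the `refl` in `playableList-select`.
    select : List V → List V → List V
    select = _

    playableList-select : ∀ X → playableList X ≡ select X (allFin (n G))
    playableList-select X with allFin (n G)
    ... | xs = refl

  select-filter : ∀ X xs → select X xs ≡ filterᵇ (playable X) xs
  select-filter X [] = refl
  select-filter X (x ∷ xs) with playable X x
  ... | true = cong (x ∷_) (select-filter X xs)
  ... | false = select-filter X xs

  playable⇒∈ : ∀ X y → playable X y ≡ true → y ∈ playableList X
  playable⇒∈ X y e rewrite playableList-select X | select-filter X (allFin (n G)) =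
    filterᵇ-∈ (playable X) (allFin (n G)) (∈-allFin y) e

  ∈⇒playable : ∀ X y → y ∈ playableList X → playable X y ≡ true
  ∈⇒playable X y i rewrite playableList-select X | select-filter X (allFin (n G)) =
    ∈-filterᵇ (playable X) (allFin (n G)) i

  -- A reply is demanded only once some playable `y` is given: when no vertex is playable the value
  -- is 0, and any bound holds.
  Dominator-upper : ∀ k X {b} →
    (∀ y → playable X y ≡ true → ∃[ z ] playable X z ≡ true × suc (value k Staller (z ∷ X)) ≤ b) →
    value (suc k) Dominator X ≤ b
  Dominator-upper k X h with playableList X | playable⇒∈ X | ∈⇒playable X
  ... | [] | _ | _ = z≤n
  ... | x ∷ xs | f | g with h x (g x (here refl))
  ... | z , p , le = ≤-trans (s≤s (foldr-⊓-≤ (λ y → value k Staller (y ∷ X)) xs (f z p))) le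

  Dominator-lower : ∀ k X {b} y → playable X y ≡ true →
    (∀ z → playable X z ≡ true → b ≤ value k Staller (z ∷ X)) →
    suc b ≤ value (suc k) Dominator X
  Dominator-lower k X y p h with playableList X | playable⇒∈ X y p | ∈⇒playable X
  ... | x ∷ xs | _ | g = s≤s (foldr-⊓-glb (λ y → value k Staller (y ∷ X)) xs λ {z} i → h z (g z i))

  Staller-upper : ∀ k X {b} →
    (∀ z → playable X z ≡ true → suc (value k Dominator (z ∷ X)) ≤ b) →
    value (suc k) Staller X ≤ b
  Staller-upper k X h with playableList X | ∈⇒playable X
  ... | [] | _ = z≤n
  ... | x ∷ xs | g = foldr-⊔-lub-suc xs λ {z} i → h z (g z i)
    where
    foldr-⊔-lub-suc : ∀ {x b} xs → (∀ {y} → y ∈ x ∷ xs → suc (value k Dominator (y ∷ X)) ≤ b) →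
      suc (foldr _⊔_ (value k Dominator (x ∷ X)) (map (λ y → value k Dominator (y ∷ X)) xs)) ≤ b
    foldr-⊔-lub-suc {b = zero} xs h = contradiction (h (here refl)) λ ()
    foldr-⊔-lub-suc {b = suc b} xs h = s≤s (foldr-⊔-lub _ xs λ i → s≤s⁻¹ (h i))

  Staller-lower : ∀ k X {b} y → playable X y ≡ true → b ≤ value k Dominator (y ∷ X) →
    suc b ≤ value (suc k) Staller X
  Staller-lower k X y p le with playableList X | playable⇒∈ X y p
  ... | x ∷ xs | i = s≤s (≤-trans le (foldr-⊔-≥ (λ y → value k Dominator (y ∷ X)) xs i))

-- Weights of runs

weight : ℕ → ℕ
weight 0 = 0
weight 1 = 0
weight 2 = 8
weight 3 = 12
weight 4 = 14
weight 5 = 15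
weight (suc (suc (suc (suc (suc (suc m)))))) = 16 + weight (suc m)

grain : ℕ → ℕ
grain 0 = 8
grain 1 = 8
grain 2 = 8
grain 3 = 4
grain 4 = 2
grain 5 = 1
grain (suc (suc (suc (suc (suc (suc m)))))) = grain (suc m)

-- The period 5 starts at length 1, since `weight 5` is 15 and not `16 + weight 0`. Hence the step
-- leads from `suc m` to `6 + m`, and there are six base cases.
period-rec : (P : ℕ → Set) → (∀ {r} → r < 6 → P r) → (∀ m → P (suc m) → P (6 + m)) → ∀ m → P m
period-rec P base step m = go m m ≤-refl
  where
  go : ∀ k m → m ≤ k → P m
  go (suc k) (suc (suc (suc (suc (suc (suc m)))))) (s≤s le) =
    step m (go k (suc m) (≤-trans (s≤s (m≤n+m m 4)) le))
  go k 0 le = base (from-yes (0 <? 6))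
  go k 1 le = base (from-yes (1 <? 6))
  go k 2 le = base (from-yes (2 <? 6))
  go k 3 le = base (from-yes (3 <? 6))
  go k 4 le = base (from-yes (4 <? 6))
  go k 5 le = base (from-yes (5 <? 6))

-- The effect of one move on the weight.
infix 4 _≺_ _≺?_
_≺_ : ℕ → ℕ → Set
x ≺ y = 1 + x ≤ y × y ≤ 15 + x

_≺?_ : ∀ x y → Dec (x ≺ y)
x ≺? y = (1 + x ≤? y) ×-dec (y ≤? 15 + x)

≺-+ : ∀ c {x y} → x ≺ y → c + x ≺ c + y
≺-+ c {x} {y} (p , q) =
  subst (_≤ c + y) (+-suc c x) (+-monoʳ-≤ c p) ,
  subst (c + y ≤_) (trans (sym (+-assoc c 15 x)) (trans (cong (_+ x) (+-comm c 15)) (+-assoc 15 c x))) (+-monoʳ-≤ c q)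

-- This is the move that clears three consecutive vertices of a run. Lengthening `a` or `b` by 5
-- from a positive length raises both sides by 16, so checking lengths below 6 suffices.
weight-split : ∀ a b → weight a + weight b ≺ weight (3 + (a + b))
weight-split = period-rec (λ a → ∀ b → weight a + weight b ≺ weight (3 + (a + b)))
  (λ {a} a<6 → period-rec _
    (from-yes (allUpTo? (λ a → allUpTo? (λ b → weight a + weight b ≺? weight (3 + (a + b))) 6) 6) a<6)
    (λ b h → shift a b h))
  (λ a h b → ≺-+ 16 (h b))
  where
  shift : ∀ a b → weight a + weight (1 + b) ≺ weight (3 + (a + (1 + b))) →
    weight a + weight (6 + b) ≺ weight (3 + (a + (6 + b)))
  shift a b h rewrite +-comm a (6 + b) | +-comm a (1 + b)
    | +-comm (weight a) (16 + weight (1 + b)) | +-comm (weight a) (weight (1 + b)) = ≺-+ 16 h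

weight-shrink₂ : ∀ a → weight a ≺ weight (2 + a)
weight-shrink₂ = period-rec _ (from-yes (allUpTo? (λ a → weight a ≺? weight (2 + a)) 6)) (λ a → ≺-+ 16)

-- For `m = 0` nothing would be lost: an isolated undominated vertex has weight 0.
weight-shrink₁ : ∀ {m} → 1 ≤ m → weight m ≺ weight (1 + m)
weight-shrink₁ {suc m} _ =
  period-rec _ (from-yes (allUpTo? (λ m → weight (1 + m) ≺? weight (2 + m)) 6)) (λ m → ≺-+ 16) m

grain∣8 : ∀ m → grain m ∣ 8
grain∣8 = period-rec _ (from-yes (allUpTo? (λ m → grain m ∣? 8) 6)) (λ m h → h)

grain∣weight : ∀ m → grain m ∣ weight m
grain∣weight = period-rec _ (from-yes (allUpTo? (λ m → grain m ∣? weight m) 6))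
  (λ m h → ∣m∣n⇒∣m+n (∣-trans (grain∣8 (suc m)) (divides 2 refl)) h)

-- The grains are 1, 2, 4 and 8, powers of two, so the smaller of two divides the larger.
grain-total : ∀ a b → grain a ≤ grain b → grain a ∣ grain b
grain-total = period-rec _
  (λ {a} a<6 → period-rec _
    (from-yes (allUpTo? (λ a → allUpTo? (λ b → dec (grain a) (grain b)) 6) 6) a<6)
    (λ b h → h))
  (λ a h → h)
  where
  dec : ∀ x y → Dec (x ≤ y → x ∣ y)
  dec x y with x ≤? y | x ∣? y
  ... | _ | yes p = yes λ _ → p
  ... | yes q | no p = no λ f → p (f q)
  ... | no q | no p = yes λ r → contradiction r q

-- A way to lower the weight of a run by 16 minus its grain, stated additively. `whole` and `end`
-- clear two vertices at one end; `mid` clears three and leaves runs on both sides. The remainder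
-- `1 + b` is positive, so lengthening it by 5 adds 16 to its weight by definition.
data Cut : ℕ → Set where
  whole : Cut 2
  end   : ∀ b → weight (3 + b) + grain (3 + b) ≡ 16 + weight (1 + b) → Cut (3 + b)
  mid   : ∀ b a → weight (4 + (b + a)) + grain (4 + (b + a)) ≡ 16 + (weight (1 + b) + weight a) →
          Cut (4 + (b + a))

-- A run of length > 2 and ≡ 2 (mod 5) is cut so as to leave a run of 2 and one of length
-- ≡ 2; a run of any other length leaves at most one vertex beside a run of length ≡ 1, or
-- of length ≡ 2 if the original length is ≡ 1.
cut : ∀ m → Cut (2 + m)
cut 0 = whole
cut 1 = end 0 refl
cut 2 = mid 0 0 refl
cut 3 = mid 0 1 refl
cut 4 = mid 1 1 refl
cut 5 = mid 1 2 refl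
cut (suc (suc (suc (suc (suc (suc m)))))) with cut (suc m)
... | end b e = end (5 + b) (cong (16 +_) e)
... | mid b a e = mid (5 + b) a (cong (16 +_) e)

-- Staller wants to lose exactly the grain. Removing a single end vertex does this unless the grain
-- is 8, in which case a `Cut` already lowers the weight by 16 - 8 = 8.
weight-shrink : ∀ m → grain (2 + m) ≡ 8 ⊎ weight (2 + m) ≡ grain (2 + m) + weight (1 + m)
weight-shrink 0 = inj₁ refl
weight-shrink 1 = inj₂ refl
weight-shrink 2 = inj₂ refl
weight-shrink 3 = inj₂ refl
weight-shrink 4 = inj₁ refl
weight-shrink (suc (suc (suc (suc (suc m))))) with weight-shrink m
... | inj₁ e = inj₁ e
... | inj₂ e = inj₂ (trans (cong (16 +_) e) (swap 16 (grain (2 + m)) (weight (1 + m))))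
  where
  swap : ∀ x y z → x + (y + z) ≡ y + (x + z)
  swap = solve-∀

-- Bit lists

-- `true` stands for an undominated vertex; positions past the end read as dominated.
at : List Bool → ℕ → Bool
at [] i = false
at (b ∷ bs) zero = b
at (b ∷ bs) (suc i) = at bs i

at-ext : ∀ bs cs → length bs ≡ length cs → (∀ i → at bs i ≡ at cs i) → bs ≡ cs
at-ext [] [] _ h = refl
at-ext (b ∷ bs) (c ∷ cs) e h = cong₂ _∷_ (h 0) (at-ext bs cs (suc-injective e) (λ i → h (suc i)))

at-++ʳ : ∀ pre bs i → at (pre ++ bs) (i + length pre) ≡ at bs i
at-++ʳ [] bs i = cong (at bs) (+-identityʳ i)
at-++ʳ (b ∷ pre) bs i rewrite +-suc i (length pre) = at-++ʳ pre bs i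

at-++ˡ : ∀ pre bs i → i < length pre → at (pre ++ bs) i ≡ at pre i
at-++ˡ (b ∷ pre) bs zero _ = refl
at-++ˡ (b ∷ pre) bs (suc i) (s≤s p) = at-++ˡ pre bs i p

at-replicate : ∀ m i → i < m → at (replicate m true) i ≡ true
at-replicate (suc m) zero _ = refl
at-replicate (suc m) (suc i) (s≤s p) = at-replicate m i p

triple-at : ∀ i (bs : List Bool) → 2 + i < length bs →
  ∃₂ λ pre post → ∃₂ λ x c → ∃[ z ] length pre ≡ i × bs ≡ pre ++ x ∷ c ∷ z ∷ post
triple-at zero (x ∷ c ∷ z ∷ bs) _ = [] , bs , x , c , z , refl , refl
triple-at zero (_ ∷ _ ∷ []) (s≤s (s≤s ()))
triple-at zero (_ ∷ []) (s≤s ())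
triple-at (suc i) (b ∷ bs) (s≤s p) with triple-at i bs p
... | pre , post , x , c , z , refl , refl = b ∷ pre , post , x , c , z , refl , refl

-- What `dominates` unfolds to on a path, with vertices replaced by their numbers.
near : ℕ → ℕ → Bool
near i j = (i ≡ᵇ j) ∨ ((suc i ≡ᵇ j) ∨ (suc j ≡ᵇ i))

-- The entry at `suc j` belongs to vertex `j`, because index 0 holds a sentinel. The centre of the
-- triple therefore belongs to vertex `length pre`.
at-clear : ∀ pre {x c z} post j →
  at (pre ++ false ∷ false ∷ false ∷ post) (suc j) ≡
  not (near (length pre) j) ∧ at (pre ++ x ∷ c ∷ z ∷ post) (suc j)
at-clear [] post 0 = refl
at-clear [] post 1 = refl
at-clear [] post (suc (suc j)) = refl
at-clear (_ ∷ []) post 0 = refl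
at-clear (_ ∷ _ ∷ pre) post 0 = refl
at-clear (_ ∷ pre) post (suc j) = at-clear pre post j

-- The first argument counts the undominated vertices of the current run read so far.
runWeight : ℕ → List Bool → ℕ
runWeight c [] = weight c
runWeight c (true ∷ bs) = runWeight (suc c) bs
runWeight c (false ∷ bs) = weight c + runWeight 0 bs

runWeight-false : ∀ c pre post →
  runWeight c (pre ++ false ∷ post) ≡ runWeight c pre + runWeight 0 post
runWeight-false c [] post = refl
runWeight-false c (true ∷ pre) post = runWeight-false (suc c) pre post
runWeight-false c (false ∷ pre) post rewrite runWeight-false 0 pre post =
  sym (+-assoc (weight c) _ _)

runWeight-true : ∀ c m bs → runWeight c (replicate m true ++ bs) ≡ runWeight (m + c) bs
runWeight-true c zero bs = refl
runWeight-true c (suc m) bs = trans (runWeight-true (suc c) m bs) (cong (λ k → runWeight k bs) (+-suc m c))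

runWeight-run : ∀ m post →
  runWeight 0 (replicate m true ++ false ∷ post) ≡ weight m + runWeight 0 post
runWeight-run m post = trans (runWeight-true 0 m (false ∷ post))
  (cong (λ k → weight k + runWeight 0 post) (+-identityʳ m))

-- `A` collects the runs already closed by a `false`, and `r` is the length of the run still open at
-- the end of `pre`.
runWeight-prefix : ∀ c pre → ∃₂ λ A r →
  (∀ post → runWeight c (pre ++ post) ≡ A + runWeight r post) ×
  (∀ i → suc i ≡ length pre → at pre i ≡ true → 1 ≤ r)
runWeight-prefix c [] = 0 , c , (λ _ → refl) , λ i ()
runWeight-prefix c (true ∷ []) = 0 , suc c , (λ _ → refl) , λ i _ _ → s≤s z≤n
runWeight-prefix c (true ∷ pre@(_ ∷ _)) with runWeight-prefix (suc c) pre
... | A , r , h , l = A , r , h , λ { (suc i) e p → l i (suc-injective e) p }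
runWeight-prefix c (false ∷ pre) with runWeight-prefix 0 pre
... | A , r , h , l = weight c + A , r ,
  (λ post → trans (cong (weight c +_) (h post)) (sym (+-assoc (weight c) A _))) ,
  λ { (suc i) e p → l i (suc-injective e) p }

-- `b` is the length of the run with which `post` begins, to be joined with `c` vertices before it;
-- `B` is the weight of the rest.
runWeight-suffix : ∀ post → ∃₂ λ b B →
  (∀ c → runWeight c post ≡ weight (b + c) + B) × (at post 0 ≡ true → 1 ≤ b)
runWeight-suffix [] = 0 , 0 , (λ c → sym (+-identityʳ _)) , λ ()
runWeight-suffix (true ∷ post) with runWeight-suffix post
... | b , B , h , _ = suc b , B ,
  (λ c → trans (h (suc c)) (cong (λ k → weight k + B) (+-suc b c))) , λ _ → s≤s z≤n
runWeight-suffix (false ∷ post) = 0 , runWeight 0 post , (λ c → refl) , λ ()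

-- Two consecutive undominated vertices, at least one of them among the three at
-- which x, c and z stand.
data Live (pre : List Bool) (post : List Bool) : Bool → Bool → Bool → Set where
  before : ∀ {c z} i → suc i ≡ length pre → at pre i ≡ true → Live pre post true c z
  left   : ∀ {z} → Live pre post true true z
  right  : ∀ {x} → Live pre post x true true
  after  : ∀ {x c} → at post 0 ≡ true → Live pre post x c true

≺-+ʳ : ∀ c {x y} → x ≺ y → x + c ≺ y + c
≺-+ʳ c {x} {y} p rewrite +-comm x c | +-comm y c = ≺-+ c p

-- Clearing three vertices splits a run, clearing two or one shortens a run. The excluded pattern
-- would shorten two runs at once, and two runs of length 2 would then lose 16, more than the
-- allowed 15.
runWeight-clear : ∀ pre post {x c z} → Live pre post x c z →
  ¬ (x ≡ true × c ≡ false × z ≡ true) →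
  runWeight 0 (pre ++ false ∷ false ∷ false ∷ post) ≺ runWeight 0 (pre ++ x ∷ c ∷ z ∷ post)
runWeight-clear pre post {x} {c} {z} live ¬tft
  with runWeight-prefix 0 pre | runWeight-suffix post
... | A , r , h , r≥1 | b , B , h′ , b≥1
  rewrite h (false ∷ false ∷ false ∷ post) | h (x ∷ c ∷ z ∷ post) = ≺-+ A (local x c z live ¬tft)
  where
  local : ∀ x c z → Live pre post x c z → ¬ (x ≡ true × c ≡ false × z ≡ true) →
    weight r + runWeight 0 post ≺ runWeight r (x ∷ c ∷ z ∷ post)
  local true true true _ _
    rewrite h′ 0 | +-identityʳ b | h′ (3 + r) | +-comm b (3 + r) | sym (+-assoc (weight r) (weight b) B) =
    ≺-+ʳ B (weight-split r b)
  local true true false _ _ = ≺-+ʳ (runWeight 0 post) (weight-shrink₂ r)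
  local true false true _ ¬tft = contradiction (refl , refl , refl) ¬tft
  local true false false (before i e p) _ = ≺-+ʳ (runWeight 0 post) (weight-shrink₁ (r≥1 i e p))
  local false true true _ _ rewrite h′ 0 | +-identityʳ b | h′ 2 | +-comm b 2 =
    ≺-+ (weight r) (≺-+ʳ B (weight-shrink₂ b))
  local false false true (after p) _ rewrite h′ 0 | +-identityʳ b | h′ 1 | +-comm b 1 =
    ≺-+ (weight r) (≺-+ʳ B (weight-shrink₁ (b≥1 p)))
  local false true false () _
  local false false false () _

-- Decomposition into runs and choice of a run of least grain

blocks : List ℕ → List Bool
blocks [] = []
blocks (m ∷ ms) = false ∷ replicate m true ++ blocks ms

blocks-++ : ∀ ls ms → blocks (ls ++ ms) ≡ blocks ls ++ blocks ms
blocks-++ [] ms = refl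
blocks-++ (l ∷ ls) ms = cong (false ∷_) (trans (cong (replicate l true ++_) (blocks-++ ls ms))
  (sym (++-assoc (replicate l true) (blocks ls) (blocks ms))))

-- A block is a `false` followed by a possibly empty run, so adjacent dominated vertices give blocks
-- of length 0. The first run stands apart, as its `false` is the left sentinel, added in
-- `finest-run-in`.
blocks-surjective : ∀ bs → ∃₂ λ m ms → bs ++ false ∷ [] ≡ replicate m true ++ blocks ms ++ false ∷ []
blocks-surjective [] = 0 , [] , refl
blocks-surjective (true ∷ bs) with blocks-surjective bs
... | m , ms , e = suc m , ms , cong (true ∷_) e
blocks-surjective (false ∷ bs) with blocks-surjective bs
... | m , ms , e = 0 , m ∷ ms , cong (false ∷_) (trans e (sym (++-assoc (replicate m true) _ _)))

runWeight-blocks : ∀ c ms → runWeight c (blocks ms ++ false ∷ []) ≡ weight c + sum (map weight ms)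
runWeight-blocks c [] = refl
runWeight-blocks c (m ∷ ms)
  rewrite ++-assoc (replicate m true) (blocks ms) (false ∷ [])
  | runWeight-true 0 m (blocks ms ++ false ∷ []) | +-identityʳ m = cong (weight c +_) (runWeight-blocks m ms)

∣-sum : ∀ {d} xs → (∀ {x} → x ∈ xs → d ∣ weight x) → d ∣ sum (map weight xs)
∣-sum {d} [] h = d ∣0
∣-sum (x ∷ xs) h = ∣m∣n⇒∣m+n (h (here refl)) (∣-sum xs (λ i → h (there i)))

long-run : ∀ ms → 0 < sum (map weight ms) → ∃[ m ] 2 + m ∈ ms
long-run (0 ∷ ms) p with long-run ms p
... | m , i = m , there i
long-run (1 ∷ ms) p with long-run ms p
... | m , i = m , there i
long-run (suc (suc m) ∷ ms) p = m , here refl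

finest-run : ∀ ms → 0 < sum (map weight ms) →
  ∃[ m ] 2 + m ∈ ms × grain (2 + m) ∣ sum (map weight ms)
finest-run ms p with long-run ms p
... | m₀ , i₀ = pick (argmin grain (2 + m₀) ms) refl
  where
  best = argmin grain (2 + m₀) ms

  best-∣ : grain best ∣ sum (map weight ms)
  best-∣ = ∣-sum ms λ {x} i → ∣-trans
    (grain-total best x (All.lookup (f[argmin]≤f[xs] {f = grain} (2 + m₀) ms) i)) (grain∣weight x)

  pick : ∀ x → x ≡ best → ∃[ m ] 2 + m ∈ ms × grain (2 + m) ∣ sum (map weight ms)
  pick (suc (suc m)) e with argmin-sel grain (2 + m₀) ms
  ... | inj₁ e′ = m , subst (_∈ ms) (sym (trans e e′)) i₀ , subst (λ k → grain k ∣ _) (sym e) best-∣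
  ... | inj₂ i = m , subst (_∈ ms) (sym e) i , subst (λ k → grain k ∣ _) (sym e) best-∣
  -- A minimiser of length 0 or 1 has grain 8 and offers no move by itself. Then 8 divides the sum,
  -- and so does the grain of the long run `2 + m₀`.
  pick 0 e = m₀ , i₀ , ∣-trans (grain∣8 (2 + m₀)) (subst (λ k → grain k ∣ _) (sym e) best-∣)
  pick 1 e = m₀ , i₀ , ∣-trans (grain∣8 (2 + m₀)) (subst (λ k → grain k ∣ _) (sym e) best-∣)

blocks-split : ∀ ls m rs → ∃₂ λ pre post →
  blocks (ls ++ m ∷ rs) ++ false ∷ [] ≡ pre ++ false ∷ replicate m true ++ false ∷ post
blocks-split ls m rs with closing rs
  where
  closing : ∀ rs → ∃[ post ] blocks rs ++ false ∷ [] ≡ false ∷ post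
  closing [] = [] , refl
  closing (_ ∷ _) = _ , refl
... | post , e = blocks ls , post , (begin
  blocks (ls ++ m ∷ rs) ++ false ∷ []                              ≡⟨ cong (_++ false ∷ []) (blocks-++ ls (m ∷ rs)) ⟩
  (blocks ls ++ blocks (m ∷ rs)) ++ false ∷ []                     ≡⟨ ++-assoc (blocks ls) _ _ ⟩
  blocks ls ++ false ∷ (replicate m true ++ blocks rs) ++ false ∷ [] ≡⟨ cong (λ l → blocks ls ++ false ∷ l) (++-assoc (replicate m true) _ _) ⟩
  blocks ls ++ false ∷ replicate m true ++ blocks rs ++ false ∷ [] ≡⟨ cong (λ l → blocks ls ++ false ∷ replicate m true ++ l) e ⟩
  blocks ls ++ false ∷ replicate m true ++ false ∷ post            ∎)
  where open ≡-Reasoning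

finest-run-in : ∀ bs → 0 < runWeight 0 (false ∷ bs ++ false ∷ []) →
  ∃₂ λ pre post → ∃[ m ]
    false ∷ bs ++ false ∷ [] ≡ pre ++ false ∷ replicate (2 + m) true ++ false ∷ post ×
    grain (2 + m) ∣ runWeight 0 (false ∷ bs ++ false ∷ [])
finest-run-in bs p with blocks-surjective bs
... | m₀ , ms₀ , e = locate
  where
  encoded : false ∷ bs ++ false ∷ [] ≡ blocks (m₀ ∷ ms₀) ++ false ∷ []
  encoded = cong (false ∷_) (trans e (sym (++-assoc (replicate m₀ true) _ _)))

  weight-sum : runWeight 0 (false ∷ bs ++ false ∷ []) ≡ sum (map weight (m₀ ∷ ms₀))
  weight-sum = trans (cong (runWeight 0) encoded) (runWeight-blocks 0 (m₀ ∷ ms₀))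

  locate : ∃₂ λ pre post → ∃[ m ]
    false ∷ bs ++ false ∷ [] ≡ pre ++ false ∷ replicate (2 + m) true ++ false ∷ post ×
    grain (2 + m) ∣ runWeight 0 (false ∷ bs ++ false ∷ [])
  locate with finest-run (m₀ ∷ ms₀) (subst (0 <_) weight-sum p)
  ... | m , i , d with ∈-∃++ i
  ... | ls , rs , e′ with blocks-split ls (2 + m) rs
  ... | pre , post , e″ = pre , post , m ,
    trans encoded (trans (cong (λ l → blocks l ++ false ∷ []) e′) e″) , subst (_ ∣_) (sym weight-sum) d

-- Auxiliary facts on Booleans, lists and divisibility

∧-true : ∀ {a b} → a ∧ b ≡ true → a ≡ true × b ≡ true
∧-true {true} {true} _ = refl , refl

≡ᵇ-refl : ∀ i → (i ≡ᵇ i) ≡ true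
≡ᵇ-refl i = Equivalence.to T-≡ (≡⇒≡ᵇ i i refl)

≡ᵇ-true : ∀ {i j} → (i ≡ᵇ j) ≡ true → i ≡ j
≡ᵇ-true {i} {j} e = ≡ᵇ⇒≡ i j (Equivalence.from T-≡ e)

∨-true : ∀ {a b} → a ∨ b ≡ true → a ≡ true ⊎ b ≡ true
∨-true {true} _ = inj₁ refl
∨-true {false} e = inj₂ e

near-true : ∀ {i j} → near i j ≡ true → i ≡ j ⊎ (suc i ≡ j ⊎ suc j ≡ i)
near-true {i} e with ∨-true e
... | inj₁ p = inj₁ (≡ᵇ-true {i} p)
... | inj₂ e′ with ∨-true e′
... | inj₁ p = inj₂ (inj₁ (≡ᵇ-true {suc i} p))
... | inj₂ p = inj₂ (inj₂ (≡ᵇ-true p))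

near-self : ∀ i → near i i ≡ true
near-self i rewrite ≡ᵇ-refl i = refl

near-suc : ∀ i → near i (suc i) ≡ true
near-suc i rewrite ≡ᵇ-refl i = ∨-zeroʳ _

near-pred : ∀ i → near (suc i) i ≡ true
near-pred i rewrite ≡ᵇ-refl i | ∨-zeroʳ (suc (suc i) ≡ᵇ i) = ∨-zeroʳ _

at-tabulate : ∀ {m} (h : Fin m → Bool) bs v → at (tabulate h ++ bs) (toℕ v) ≡ h v
at-tabulate h bs zero = refl
at-tabulate h bs (suc v) = at-tabulate (h ∘ suc) bs v

at-tabulate-true : ∀ {m} (h : Fin m → Bool) j → at (tabulate h ++ false ∷ []) j ≡ true →
  ∃[ v ] toℕ v ≡ j × h v ≡ true
at-tabulate-true {zero} h (suc j) ()
at-tabulate-true {suc m} h zero e = zero , refl , e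
at-tabulate-true {suc m} h (suc j) e with at-tabulate-true (h ∘ suc) j e
... | v , p , q = suc v , cong suc p , q

at-tabulate-∧ : ∀ {m} (p : ℕ → Bool) {h h′ : Fin m → Bool} → (∀ v → h v ≡ p (toℕ v) ∧ h′ v) →
  ∀ j → at (tabulate h ++ false ∷ []) j ≡ p j ∧ at (tabulate h′ ++ false ∷ []) j
at-tabulate-∧ {zero} p e zero = sym (∧-zeroʳ (p 0))
at-tabulate-∧ {zero} p e (suc j) = sym (∧-zeroʳ (p (suc j)))
at-tabulate-∧ {suc m} p e zero = e zero
at-tabulate-∧ {suc m} p e (suc j) = at-tabulate-∧ (p ∘ suc) (e ∘ suc) j

replicate-∷ : ∀ b bs → replicate b true ++ true ∷ bs ≡ true ∷ replicate b true ++ bs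
replicate-∷ zero bs = refl
replicate-∷ (suc b) bs = cong (true ∷_) (replicate-∷ b bs)

replicate-++ : ∀ b a bs → replicate b true ++ replicate a true ++ bs ≡ replicate (b + a) true ++ bs
replicate-++ zero a bs = refl
replicate-++ (suc b) a bs = cong (true ∷_) (replicate-++ b a bs)

tabulate-true : ∀ m → tabulate {n = m} (λ _ → true) ≡ replicate m true
tabulate-true zero = refl
tabulate-true (suc m) = cong (true ∷_) (tabulate-true m)

-- Here `b + d` is the next multiple of `d` after `b`. This is the step in which divisibility
-- absorbs the rounding.
∣-closes : ∀ {d a b} → d ∣ a → d ∣ b → a < b + d → a ≤ b
∣-closes {d} (divides p refl) (divides q refl) lt =
  *-monoˡ-≤ d (s≤s⁻¹ (*-cancelʳ-< d p (suc q) (subst (p * d <_) (+-comm (q * d) d) lt)))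

replicate-mid : ∀ pre b a bs → pre ++ false ∷ replicate (3 + (b + a)) true ++ bs ≡
  (pre ++ false ∷ replicate b true) ++ true ∷ true ∷ true ∷ replicate a true ++ bs
replicate-mid pre b a bs
  rewrite ++-assoc pre (false ∷ replicate b true) (true ∷ true ∷ true ∷ replicate a true ++ bs)
  | replicate-∷ b (true ∷ true ∷ replicate a true ++ bs) | replicate-∷ b (true ∷ replicate a true ++ bs)
  | replicate-∷ b (replicate a true ++ bs) | replicate-++ b a bs = refl

runWeight-mid : ∀ pre b a post →
  runWeight 0 ((pre ++ false ∷ replicate b true) ++ false ∷ false ∷ false ∷ replicate a true ++ false ∷ post) ≡
  runWeight 0 pre + (weight b + weight a + runWeight 0 post)
runWeight-mid pre b a post
  rewrite ++-assoc pre (false ∷ replicate b true) (false ∷ false ∷ false ∷ replicate a true ++ false ∷ post)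
  | runWeight-false 0 pre (replicate b true ++ false ∷ false ∷ false ∷ replicate a true ++ false ∷ post)
  | runWeight-run b (false ∷ false ∷ replicate a true ++ false ∷ post)
  | runWeight-run a post | +-assoc (weight b) (weight a) (runWeight 0 post) = refl

*-≤⇒≤-/ : ∀ d .{{_ : NonZero d}} {a b} → d * a ≤ b → a ≤ b / d
*-≤⇒≤-/ d {a} {b} le = subst (_≤ b / d) (m*n/n≡m a d) (/-monoˡ-≤ d (subst (_≤ b) (*-comm d a) le))

≤-/⇒*-≤ : ∀ d .{{_ : NonZero d}} {a b} → a ≤ b / d → d * a ≤ b
≤-/⇒*-≤ d {a} {b} le = ≤-trans (*-monoʳ-≤ d le) (subst (_≤ b) (*-comm (b / d) d) (m/n*n≤m b d))

-- The game on a path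

module PathGame (n : ℕ) where
  open Game (P n)
  open GameProperties (P n)

  -- The dominated sentinels at both ends shift vertex v to index 1 + v.
  bits : List V → List Bool
  bits X = false ∷ tabulate (λ v → not (inN X v)) ++ false ∷ []

  potential : List V → ℕ
  potential X = runWeight 0 (bits X)

  length-bits : ∀ X → length (bits X) ≡ 2 + n
  length-bits X = cong suc (begin
    length (tabulate free ++ false ∷ [])  ≡⟨ length-++ (tabulate free) ⟩
    length (tabulate free) + 1            ≡⟨ cong (_+ 1) (length-tabulate free) ⟩
    n + 1                                 ≡⟨ +-comm n 1 ⟩
    1 + n                                 ∎)
    where
    open ≡-Reasoning
    free : V → Bool
    free v = not (inN X v)

  at-bits : ∀ X v → at (bits X) (suc (toℕ v)) ≡ not (inN X v)
  at-bits X v = at-tabulate (λ v → not (inN X v)) _ v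

  at-bits-true : ∀ X j → at (bits X) (suc j) ≡ true → ∃[ v ] toℕ v ≡ j × not (inN X v) ≡ true
  at-bits-true X = at-tabulate-true (λ v → not (inN X v))

  -- Valid for every natural number `j`: beyond the last vertex both sides are `false`, by the right
  -- sentinel and the default of `at`.
  at-bits-∷ : ∀ u X j → at (bits (u ∷ X)) (suc j) ≡ not (near (toℕ u) j) ∧ at (bits X) (suc j)
  at-bits-∷ u X = at-tabulate-∧ (λ j → not (near (toℕ u) j))
    (λ v → deMorgan₂ (dominates u v) (inN X v))

  -- Because of the sentinel shift, the triple starting at index `toℕ y` consists of `y` and its two
  -- neighbours, a sentinel replacing a missing neighbour.
  record At (X : List V) (y : V) (pre : List Bool) (x c z : Bool) (post : List Bool) : Set where
    constructor _,_
    field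
      factors : bits X ≡ pre ++ x ∷ c ∷ z ∷ post
      offset  : length pre ≡ toℕ y
  open At

  bits-move : ∀ {X y pre x c z post} → At X y pre x c z post →
    bits (y ∷ X) ≡ pre ++ false ∷ false ∷ false ∷ post
  bits-move {X} {y} {pre} {x} {c} {z} {post} (e , l) = at-ext _ _
    (trans (length-bits (y ∷ X)) (trans (sym (length-bits X)) (trans (cong length e)
      (trans (length-++ pre) (sym (length-++ pre))))))
    -- Index 0 is the left sentinel, which belongs to no vertex and stays `false`.
    λ { zero → head pre e
      ; (suc j) → trans (at-bits-∷ y X j) (trans (cong₂ (λ k bs → not (near k j) ∧ at bs (suc j)) (sym l) e)
          (sym (at-clear pre post j))) }
    where
    head : ∀ pre → bits X ≡ pre ++ x ∷ c ∷ z ∷ post → false ≡ at (pre ++ false ∷ false ∷ false ∷ post) 0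
    head [] _ = refl
    head (_ ∷ pre) e = cong (λ bs → at bs 0) e

  -- The triple occupies three of the `2 + n` entries, so its centre is a vertex and not a sentinel.
  vertex-at : ∀ X pre {x c z post} → bits X ≡ pre ++ x ∷ c ∷ z ∷ post →
    ∃[ y ] At X y pre x c z post
  vertex-at X pre {x} {c} {z} {post} e = fromℕ< p , e , sym (toℕ-fromℕ< p)
    where
    p : length pre < n
    p = +-cancelˡ-≤ 2 _ _ (subst (3 + length pre ≤_)
      (trans (sym (length-++ pre)) (trans (cong length (sym e)) (length-bits X)))
      (subst (_≤ length pre + (3 + length post)) (+-comm (length pre) 3)
        (+-monoʳ-≤ (length pre) (m≤m+n 3 (length post)))))

  at-vertex : ∀ X y → ∃₂ λ pre post → ∃₂ λ x c → ∃[ z ] At X y pre x c z post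
  at-vertex X y with triple-at (toℕ y) (bits X) (subst (2 + toℕ y <_) (sym (length-bits X)) (s≤s (s≤s (toℕ<n y))))
  ... | pre , post , x , c , z , l , e = pre , post , x , c , z , e , l

  -- A component with at least two vertices is detected by an edge `i`, `j` of undominated vertices.
  -- That both numbers are vertices follows from their bits being `true`. `playable-witness` is the
  -- converse.
  playable-true : ∀ X y {i j} → near (toℕ y) i ≡ true → suc i ≡ j ⊎ suc j ≡ i →
    at (bits X) (suc i) ≡ true → at (bits X) (suc j) ≡ true → playable X y ≡ true
  playable-true X y {i} {j} d a p q with at-bits-true X i p | at-bits-true X j q
  ... | v , refl , p′ | w , refl , q′ = any-intro _ (allFin n) (∈-allFin v)
    (cong₂ _∧_ d (cong₂ _∧_ p′ (any-intro _ (allFin n) (∈-allFin w) (cong₂ _∧_ (adjacent a) q′))))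
    where
    adjacent : suc (toℕ v) ≡ toℕ w ⊎ suc (toℕ w) ≡ toℕ v → pathAdj n v w ≡ true
    adjacent (inj₁ e) rewrite sym e | ≡ᵇ-refl (toℕ v) = refl
    adjacent (inj₂ e) rewrite sym e | ≡ᵇ-refl (toℕ w) = ∨-zeroʳ _

  playable-witness : ∀ X y → playable X y ≡ true → ∃₂ λ i j → near (toℕ y) i ≡ true ×
    (suc i ≡ j ⊎ suc j ≡ i) × at (bits X) (suc i) ≡ true × at (bits X) (suc j) ≡ true
  playable-witness X y e with any-elim _ (allFin n) e
  ... | v , ev with ∧-true ev
  ... | d , ev′ with ∧-true ev′
  ... | p , ew with any-elim _ (allFin n) ew
  ... | w , ew′ with ∧-true ew′
  ... | a , q = toℕ v , toℕ w , d , adjacent (∨-true a) ,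
    trans (at-bits X v) p , trans (at-bits X w) q
    where
    adjacent : (suc (toℕ v) ≡ᵇ toℕ w) ≡ true ⊎ (suc (toℕ w) ≡ᵇ toℕ v) ≡ true →
      suc (toℕ v) ≡ toℕ w ⊎ suc (toℕ w) ≡ toℕ v
    adjacent (inj₁ e) = inj₁ (≡ᵇ-true e)
    adjacent (inj₂ e) = inj₂ (≡ᵇ-true e)

  module _ {X y pre x c z post} (h : At X y pre x c z post) where
    private
      e = factors h
      l = offset h

    reads : ∀ k → at (bits X) (k + toℕ y) ≡ at (x ∷ c ∷ z ∷ post) k
    reads k rewrite e | sym l = at-++ʳ pre (x ∷ c ∷ z ∷ post) k

    reads-before : ∀ i → suc i ≡ length pre → at (bits X) i ≡ at pre i
    reads-before i p rewrite e = at-++ˡ pre _ i (≤-reflexive p)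

    playable⇒Live : playable X y ≡ true → Live pre post x c z
    playable⇒Live p with playable-witness X y p
    ... | i , j , d , a , pi , pj = live (near-true {toℕ y} d) a pi pj
      where
      x-true : ∀ {i} → suc i ≡ toℕ y → at (bits X) (suc i) ≡ true → x ≡ true
      x-true ei p = trans (sym (reads 0)) (trans (cong (at (bits X)) (sym ei)) p)

      leftᵉ : x ≡ true → c ≡ true → Live pre post x c z
      leftᵉ refl refl = left

      rightᵉ : c ≡ true → z ≡ true → Live pre post x c z
      rightᵉ refl refl = right

      beforeᵉ : ∀ i → suc i ≡ length pre → at pre i ≡ true → x ≡ true → Live pre post x c z
      beforeᵉ i p q refl = before i p q

      afterᵉ : at post 0 ≡ true → z ≡ true → Live pre post x c z
      afterᵉ p refl = after p

      live : ∀ {i j} → toℕ y ≡ i ⊎ (suc (toℕ y) ≡ i ⊎ suc i ≡ toℕ y) → suc i ≡ j ⊎ suc j ≡ i →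
        at (bits X) (suc i) ≡ true → at (bits X) (suc j) ≡ true → Live pre post x c z
      live (inj₁ refl) (inj₁ refl) pi pj = rightᵉ (trans (sym (reads 1)) pi) (trans (sym (reads 2)) pj)
      live (inj₁ refl) (inj₂ ej) pi pj = leftᵉ (x-true ej pj) (trans (sym (reads 1)) pi)
      live (inj₂ (inj₁ refl)) (inj₁ refl) pi pj = afterᵉ (trans (sym (reads 3)) pj) (trans (sym (reads 2)) pi)
      live (inj₂ (inj₁ refl)) (inj₂ refl) pi pj = rightᵉ (trans (sym (reads 1)) pj) (trans (sym (reads 2)) pi)
      live (inj₂ (inj₂ ei)) (inj₁ refl) pi pj =
        leftᵉ (x-true ei pi) (trans (sym (reads 1)) (trans (cong (λ k → at (bits X) (suc k)) (sym ei)) pj))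
      live {j = j} (inj₂ (inj₂ ei)) (inj₂ refl) pi pj =
        beforeᵉ (suc j) (trans ei (sym l)) (trans (sym (reads-before (suc j) (trans ei (sym l)))) pj)
          (x-true ei pi)

    Live⇒playable : Live pre post x c z → playable X y ≡ true
    Live⇒playable right = playable-true X y (near-self (toℕ y)) (inj₁ refl) (reads 1) (reads 2)
    Live⇒playable (after p) =
      playable-true X y (near-suc (toℕ y)) (inj₁ refl) (reads 2) (trans (reads 3) p)
    -- The left entry has index `toℕ y`. At index 0 it would be the sentinel, which is `false`, so
    -- `toℕ y` is a successor.
    Live⇒playable left = inner (toℕ y) refl (reads 0)
      where
      inner : ∀ k → k ≡ toℕ y → at (bits X) k ≡ true → playable X y ≡ true
      inner (suc j) ey r = playable-true X y {suc j} {j}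
        (subst (λ k → near k (suc j) ≡ true) ey (near-self (suc j))) (inj₂ refl)
        (subst (λ k → at (bits X) (suc k) ≡ true) (sym ey) (reads 1)) r
    Live⇒playable (before zero el p) with trans (reads-before 0 el) p
    ... | ()
    Live⇒playable (before (suc j) el p) = playable-true X y {suc j} {j}
      (subst (λ k → near k (suc j) ≡ true) ey (near-pred (suc j))) (inj₂ refl)
      (subst (λ k → at (bits X) k ≡ true) (sym ey) (reads 0))
      (trans (reads-before (suc j) el) p)
      where
      ey : suc (suc j) ≡ toℕ y
      ey = trans el l

  -- A selected vertex dominates its neighbours, so a dominated vertex never lies
  -- between two undominated ones.
  dominated-neighbour : ∀ X y → inN X y ≡ true →
    at (bits X) (toℕ y) ≡ false ⊎ at (bits X) (2 + toℕ y) ≡ false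
  dominated-neighbour (u ∷ X) y e with ∨-true {dominates u y} e
  ... | inj₂ e′ with dominated-neighbour X y e′
  ... | inj₂ p = inj₂ (trans (at-bits-∷ u X (suc (toℕ y)))
    (trans (cong (_ ∧_) p) (∧-zeroʳ (not (near (toℕ u) (suc (toℕ y)))))))
  ... | inj₁ p = inj₁ (earlier (toℕ y) p)
    where
    earlier : ∀ k → at (bits X) k ≡ false → at (bits (u ∷ X)) k ≡ false
    earlier zero _ = refl
    earlier (suc j) p = trans (at-bits-∷ u X j) (trans (cong (_ ∧_) p) (∧-zeroʳ (not (near (toℕ u) j))))
  dominated-neighbour (u ∷ X) y e | inj₁ d with near-true {toℕ u} d
  ... | inj₁ p = inj₂ (trans (at-bits-∷ u X (suc (toℕ y)))
    (cong (λ b → not b ∧ _) (subst (λ k → near (toℕ u) (suc k) ≡ true) p (near-suc (toℕ u)))))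
  ... | inj₂ (inj₁ p) rewrite sym p = inj₁ (trans (at-bits-∷ u X (toℕ u))
    (cong (λ b → not b ∧ at (bits X) (suc (toℕ u))) (near-self (toℕ u))))
  ... | inj₂ (inj₂ p) = inj₂ (trans (at-bits-∷ u X (suc (toℕ y)))
    (cong (λ b → not b ∧ _) (subst (λ k → near (toℕ u) k ≡ true) (sym p) (near-self (toℕ u)))))

  no-isolated-gap : ∀ {X y pre x c z post} → At X y pre x c z post →
    ¬ (x ≡ true × c ≡ false × z ≡ true)
  no-isolated-gap {X} {y} h (refl , refl , refl)
    with dominated-neighbour X y (not-injective (trans (sym (at-bits X y)) (reads h 1)))
  ... | inj₁ p = contradiction (trans (sym (reads h 0)) p) λ ()
  ... | inj₂ p = contradiction (trans (sym (reads h 2)) p) λ ()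

  move-≺ : ∀ X y → playable X y ≡ true → potential (y ∷ X) ≺ potential X
  move-≺ X y p with at-vertex X y
  ... | pre , post , x , c , z , h =
    subst₂ _≺_ (cong (runWeight 0) (sym (bits-move h))) (cong (runWeight 0) (sym (factors h)))
      (runWeight-clear pre post (playable⇒Live h p) (no-isolated-gap h))

  -- Moves with a prescribed effect on the potential

  record Move (X : List V) (w : ℕ) : Set where
    constructor move
    field
      vertex    : V
      legal     : playable X vertex ≡ true
      remaining : potential (vertex ∷ X) ≡ w
  open Move

  move-at : ∀ X pre {x c z} post → bits X ≡ pre ++ x ∷ c ∷ z ∷ post → Live pre post x c z →
    Move X (runWeight 0 (pre ++ false ∷ false ∷ false ∷ post))
  move-at X pre post e l =
    let y , h = vertex-at X pre e in move y (Live⇒playable h l) (cong (runWeight 0) (bits-move h))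

  record Run (X : List V) (m : ℕ) (pre post : List Bool) : Set where
    constructor run
    field
      split : bits X ≡ pre ++ false ∷ replicate m true ++ false ∷ post
  open Run

  runWeight-around : ∀ pre m post → runWeight 0 (pre ++ false ∷ replicate m true ++ false ∷ post) ≡
    runWeight 0 pre + (weight m + runWeight 0 post)
  runWeight-around pre m post =
    trans (runWeight-false 0 pre _) (cong (runWeight 0 pre +_) (runWeight-run m post))

  potential-run : ∀ {X m pre post} → Run X m pre post →
    potential X ≡ runWeight 0 pre + (weight m + runWeight 0 post)
  potential-run {m = m} {pre} {post} r = trans (cong (runWeight 0) (split r)) (runWeight-around pre m post)

  -- The vertex selected is the first of the run; it dominates the second one as well.
  cut-end : ∀ {X} b {pre post} → Run X (2 + b) pre post →
    Move X (runWeight 0 pre + (weight b + runWeight 0 post))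
  cut-end {X} b {pre} {post} r = subst (Move X) (runWeight-around-end pre)
    (move-at X pre (replicate b true ++ false ∷ post) (split r) right)
    where
    runWeight-around-end : ∀ pre → runWeight 0 (pre ++ false ∷ false ∷ false ∷ replicate b true ++ false ∷ post) ≡
      runWeight 0 pre + (weight b + runWeight 0 post)
    runWeight-around-end pre = trans (runWeight-false 0 pre _) (cong (runWeight 0 pre +_) (runWeight-run b post))

  cut-mid : ∀ {X} b a {pre post} → Run X (3 + (b + a)) pre post →
    Move X (runWeight 0 pre + (weight b + weight a + runWeight 0 post))
  cut-mid {X} b a {pre} {post} r = subst (Move X) (runWeight-mid pre b a post)
    (move-at X (pre ++ false ∷ replicate b true) (replicate a true ++ false ∷ post)
      (trans (split r) (replicate-mid pre b a (false ∷ post))) right)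

  cut-move : ∀ {X m pre post} → Cut m → Run X m pre post →
    ∃[ w ] w + 16 ≡ potential X + grain m × Move X w
  cut-move {X} {m} {pre} {post} ct r = choose ct r
    where
    exchange : ∀ p q {w u g} → w + g ≡ 16 + u → p + (u + q) + 16 ≡ p + (w + q) + g
    exchange p q {w} {u} {g} e = trans (left-form p u q)
      (trans (cong (λ k → p + (k + q)) (sym e)) (right-form p w q g))
      where
      left-form : ∀ p u q → p + (u + q) + 16 ≡ p + (16 + u + q)
      left-form = solve-∀
      right-form : ∀ p w q g → p + (w + g + q) ≡ p + (w + q) + g
      right-form = solve-∀

    balance : ∀ {m u} → Run X m pre post → weight m + grain m ≡ 16 + u →
      runWeight 0 pre + (u + runWeight 0 post) + 16 ≡ potential X + grain m
    balance {m} r e = trans (exchange (runWeight 0 pre) (runWeight 0 post) {weight m} e)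
      (cong (_+ grain m) (sym (potential-run r)))

    choose : ∀ {m} → Cut m → Run X m pre post → ∃[ w ] w + 16 ≡ potential X + grain m × Move X w
    choose whole r = _ , balance r refl , cut-end 0 r
    choose (end b e) r = _ , balance r e , cut-end (1 + b) r
    choose (mid b a e) r = _ , balance r e , cut-mid (1 + b) a r

  -- Comparing lengths gives `m = n`, so the selected vertex `u` would be undominated.
  touched : ∀ u X m → ¬ bits (u ∷ X) ≡ false ∷ replicate m true ++ false ∷ []
  touched u X m e = contradiction (trans (sym dominated) undominated) λ ()
    where
    n≡m : n ≡ m
    n≡m = suc-injective (suc-injective (trans (sym (length-bits (u ∷ X))) (trans (cong length e)
      (cong suc (trans (length-++ (replicate m true)) (trans (cong (_+ 1) (length-replicate m)) (+-comm m 1)))))))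

    dominated : at (bits (u ∷ X)) (suc (toℕ u)) ≡ false
    dominated = trans (at-bits-∷ u X (toℕ u)) (cong (λ b → not b ∧ at (bits X) (suc (toℕ u))) (near-self (toℕ u)))

    undominated : at (bits (u ∷ X)) (suc (toℕ u)) ≡ true
    undominated = trans (cong (λ bs → at bs (suc (toℕ u))) e)
      (trans (at-++ˡ (replicate m true) _ (toℕ u) (subst (toℕ u <_) (sym (length-replicate m)) u<m))
        (at-replicate m (toℕ u) u<m))
      where
      u<m : toℕ u < m
      u<m = subst (toℕ u <_) n≡m (toℕ<n u)

  -- The move is the dominated vertex just before the run. `b` cannot be `true` by
  -- `no-isolated-gap`, so the first vertex of the run is the only one lost.
  shrink-left : ∀ X m pre b post → bits X ≡ pre ++ b ∷ false ∷ replicate (2 + m) true ++ false ∷ post →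
    Move X (runWeight 0 (pre ++ b ∷ []) + (weight (1 + m) + runWeight 0 post))
  shrink-left X m pre true post e =
    contradiction (refl , refl , refl) (no-isolated-gap (proj₂ (vertex-at X pre e)))
  shrink-left X m pre false post e = subst (Move X) remains
    (move-at X pre (replicate (1 + m) true ++ false ∷ post) e (after refl))
    where
    remains : runWeight 0 (pre ++ false ∷ false ∷ false ∷ replicate (1 + m) true ++ false ∷ post) ≡
      runWeight 0 (pre ++ false ∷ []) + (weight (1 + m) + runWeight 0 post)
    remains rewrite runWeight-false 0 pre (false ∷ false ∷ replicate (1 + m) true ++ false ∷ post)
      | runWeight-false 0 pre [] | +-identityʳ (runWeight 0 pre) =
      cong (runWeight 0 pre +_) (runWeight-run (1 + m) post)

  shrink-right : ∀ X m b post → bits X ≡ false ∷ replicate (2 + m) true ++ false ∷ b ∷ post →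
    Move X (weight (1 + m) + runWeight 0 (b ∷ post))
  shrink-right X m b post e = choose b
    (trans e (cong (false ∷_) (sym (replicate-∷ (1 + m) (false ∷ b ∷ post)))))
    where
    choose : ∀ b → bits X ≡ (false ∷ replicate (1 + m) true) ++ true ∷ false ∷ b ∷ post →
      Move X (weight (1 + m) + runWeight 0 (b ∷ post))
    choose true e = contradiction (refl , refl , refl)
      (no-isolated-gap (proj₂ (vertex-at X (false ∷ replicate (1 + m) true) e)))
    choose false e = subst (Move X) (runWeight-run (1 + m) (false ∷ false ∷ post))
      (move-at X (false ∷ replicate (1 + m) true) post e
        (before (suc m) (cong (2 +_) (sym (length-replicate m))) (at-replicate (suc m) m ≤-refl)))

  -- The vertex to play is a dominated neighbour of the run. An empty `pre` or `post` means that the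
  -- bounding entry there is a sentinel; `touched` rules out sentinels on both sides.
  shrink : ∀ {u X} m {pre post} → Run (u ∷ X) (2 + m) pre post →
    Move (u ∷ X) (runWeight 0 pre + (weight (1 + m) + runWeight 0 post))
  shrink {u} {X} m {pre} {post} r = choose (initLast pre) post (split r)
    where
    choose : ∀ {pre} → InitLast pre → ∀ post → bits (u ∷ X) ≡ pre ++ false ∷ replicate (2 + m) true ++ false ∷ post →
      Move (u ∷ X) (runWeight 0 pre + (weight (1 + m) + runWeight 0 post))
    choose [] [] e = contradiction e (touched u X (2 + m))
    choose [] (b ∷ post) e = shrink-right (u ∷ X) m b post e
    choose (pre ∷ʳ′ b) post e = shrink-left (u ∷ X) m pre b post (trans e (++-assoc pre (b ∷ []) _))

  Dominator-move : ∀ X → 0 < potential X →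
    ∃₂ λ w d → w + 16 ≡ potential X + d × d ∣ potential X × d ∣ 8 × Move X w
  Dominator-move X pos =
    let pre , post , m , e , d∣ = finest-run-in (tabulate λ v → not (inN X v)) pos
        w , q , mv = cut-move (cut m) (run {pre = pre} {post} e)
    in w , grain (2 + m) , q , d∣ , grain∣8 (2 + m) , mv

  Staller-move : ∀ u X → 0 < potential (u ∷ X) →
    ∃₂ λ w d → potential (u ∷ X) ≡ d + w × d ∣ potential (u ∷ X) × d ∣ 8 × Move (u ∷ X) w
  Staller-move u X pos =
    let pre , post , m , e , d∣ = finest-run-in (tabulate λ v → not (inN (u ∷ X) v)) pos
    in choose m (run {pre = pre} {post} e) d∣ (weight-shrink m)
    where
    halve : ∀ {w p g} → g ≡ 8 → w + 16 ≡ p + g → p ≡ 8 + w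
    halve {w} {p} refl q = +-cancelʳ-≡ 8 p (8 + w)
      (trans (sym q) (trans (sym (+-assoc w 8 8)) (cong (_+ 8) (+-comm w 8))))

    regroup : ∀ p g w q → p + (g + w + q) ≡ g + (p + (w + q))
    regroup = solve-∀

    choose : ∀ m {pre post} → Run (u ∷ X) (2 + m) pre post → grain (2 + m) ∣ potential (u ∷ X) →
      grain (2 + m) ≡ 8 ⊎ weight (2 + m) ≡ grain (2 + m) + weight (1 + m) →
      ∃₂ λ w d → potential (u ∷ X) ≡ d + w × d ∣ potential (u ∷ X) × d ∣ 8 × Move (u ∷ X) w
    -- With grain 8 the cut used by Dominator costs 16 - 8 = 8, exactly the grain.
    choose m r d∣ (inj₁ g≡8) =
      let w , q , mv = cut-move (cut m) r
      in w , 8 , halve g≡8 q , subst (_∣ potential (u ∷ X)) g≡8 d∣ , ∣-refl , mv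
    choose m {pre} {post} r d∣ (inj₂ q) = _ , grain (2 + m) ,
      trans (potential-run r) (trans (cong (λ k → runWeight 0 pre + (k + runWeight 0 post)) q)
        (regroup (runWeight 0 pre) (grain (2 + m)) (weight (1 + m)) (runWeight 0 post))) ,
      d∣ , grain∣8 (2 + m) , shrink m r

  -- Upper bounds on both values

  mutual
    Dominator-≤ : ∀ k X → value k Dominator X ≤ potential X / 8
    Dominator-≤ zero X = z≤n
    Dominator-≤ (suc k) X = Dominator-upper k X λ y p → reply (Dominator-move X (≤-trans (s≤s z≤n) (proj₁ (move-≺ X y p))))
      where
      reply : (∃₂ λ w d → w + 16 ≡ potential X + d × d ∣ potential X × d ∣ 8 × Move X w) →
        ∃[ z ] playable X z ≡ true × suc (value k Staller (z ∷ X)) ≤ potential X / 8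
      -- The bound for Staller to move is rounded up, so by itself it only gives a strict inequality
      -- against `potential X + d`. Both `potential X` and the multiple of 8 are divisible by `d`,
      -- so `∣-closes` removes the excess.
      reply (w , d , q , d∣ , d∣8 , move z p refl) = z , p , *-≤⇒≤-/ 8 (∣-closes (∣m⇒∣m*n (suc (value k Staller (z ∷ X))) d∣8) d∣ (begin
        suc (8 * suc (value k Staller (z ∷ X)))   ≡⟨ cong suc (*-suc 8 (value k Staller (z ∷ X))) ⟩
        9 + 8 * value k Staller (z ∷ X)           ≤⟨ +-monoʳ-≤ 9 (≤-/⇒*-≤ 8 (Staller-≤ k (z ∷ X))) ⟩
        16 + potential (z ∷ X)                    ≡⟨ +-comm 16 (potential (z ∷ X)) ⟩
        potential (z ∷ X) + 16                    ≡⟨ q ⟩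
        potential X + d                           ∎))
        where open ≤-Reasoning

    Staller-≤ : ∀ k X → value k Staller X ≤ (7 + potential X) / 8
    Staller-≤ zero X = z≤n
    Staller-≤ (suc k) X = Staller-upper k X reply
      where
      reply : ∀ z → playable X z ≡ true → suc (value k Dominator (z ∷ X)) ≤ (7 + potential X) / 8
      reply z p = *-≤⇒≤-/ 8 (begin
        8 * suc (value k Dominator (z ∷ X))       ≡⟨ *-suc 8 (value k Dominator (z ∷ X)) ⟩
        8 + 8 * value k Dominator (z ∷ X)         ≤⟨ +-monoʳ-≤ 8 (≤-/⇒*-≤ 8 (Dominator-≤ k (z ∷ X))) ⟩
        8 + potential (z ∷ X)                     ≤⟨ +-monoʳ-≤ 7 (proj₁ (move-≺ X z p)) ⟩
        7 + potential X                           ∎)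
        where open ≤-Reasoning

  -- Lower bounds on both values

  mutual
    -- With fuel 0 the value is 0, so a lower bound `j` asks for fuel at least `j`, unlike the upper
    -- bounds.
    Dominator-≥ : ∀ k X j → j ≤ k → 8 * j ≤ potential X → j ≤ value k Dominator X
    Dominator-≥ k X zero _ _ = z≤n
    Dominator-≥ (suc k) X (suc j) (s≤s j≤k) le = reply (Dominator-move X (≤-trans (≤-trans (s≤s z≤n) (m≤m*n 8 (suc j))) le))
      where
      open ≤-Reasoning
      reply : (∃₂ λ w d → w + 16 ≡ potential X + d × d ∣ potential X × d ∣ 8 × Move X w) →
        suc j ≤ value (suc k) Dominator X
      -- The move `y` certifies that the game is not over. Whatever `z` Dominator picks lowers the
      -- potential by at most 15 = 8 + 7, where 7 is the slack in the bound for Staller to move.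
      reply (_ , _ , _ , _ , _ , move y p _) = Dominator-lower k X y p λ z pz →
        Staller-≥ k z X j j≤k (+-cancelˡ-≤ 8 _ _ (begin
          8 + 8 * j                   ≡⟨ *-suc 8 j ⟨
          8 * suc j                   ≤⟨ le ⟩
          potential X                 ≤⟨ proj₂ (move-≺ X z pz) ⟩
          15 + potential (z ∷ X)      ∎))

    Staller-≥ : ∀ k u X j → j ≤ k → 8 * j ≤ 7 + potential (u ∷ X) → j ≤ value k Staller (u ∷ X)
    Staller-≥ k u X zero _ _ = z≤n
    Staller-≥ (suc k) u X (suc j) (s≤s j≤k) le =
      reply (Staller-move u X (+-cancelˡ-≤ 7 _ _ (≤-trans (m≤m*n 8 (suc j)) le)))
      where
      open ≤-Reasoning
      reply : (∃₂ λ w d → potential (u ∷ X) ≡ d + w × d ∣ potential (u ∷ X) × d ∣ 8 × Move (u ∷ X) w) →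
        suc j ≤ value (suc k) Staller (u ∷ X)
      reply (w , d , q , d∣ , d∣8 , move y p refl) = Staller-lower k (u ∷ X) y p
        (Dominator-≥ k (y ∷ u ∷ X) j j≤k (+-cancelˡ-≤ 8 _ _ (begin
          8 + 8 * j         ≡⟨ *-suc 8 j ⟨
          -- `d` divides the potential `d + w`, hence also `8 + w`, and `bound` leaves a gap smaller
          -- than `d`.
          8 * suc j         ≤⟨ ∣-closes (∣m⇒∣m*n (suc j) d∣8)
                                 (∣m∣n⇒∣m+n d∣8 (∣m+n∣m⇒∣n (subst (d ∣_) q d∣) ∣-refl)) bound ⟩
          8 + w             ∎)))
        where
        bound : 8 * suc j < 8 + w + d
        bound = s≤s (begin
          8 * suc j                  ≤⟨ le ⟩
          7 + potential (u ∷ X)      ≡⟨ cong (7 +_) (trans q (+-comm d w)) ⟩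
          7 + (w + d)                ∎)

  start : Run [] n [] []
  start = run (cong (λ bs → false ∷ bs ++ false ∷ []) (tabulate-true n))

  potential-[] : potential [] ≡ weight n
  potential-[] = trans (potential-run start) (+-identityʳ (weight n))

-- Bounds for the untouched path

open PathGame

ιg-upper : ∀ n → ιg (P n) ≤ weight n / 8
ιg-upper n = subst (λ w → ιg (P n) ≤ w / 8) (potential-[] n) (Dominator-≤ n (suc n) [])

ιg-lower : ∀ n j → j ≤ suc n → 8 * j ≤ weight n → j ≤ ιg (P n)
ιg-lower n j small le = Dominator-≥ n (suc n) [] j small (subst (8 * j ≤_) (sym (potential-[] n)) le)

ιg′-upper : ∀ n → ιg′ (P n) ≤ (7 + weight n) / 8
ιg′-upper n = subst (λ w → ιg′ (P n) ≤ (7 + w) / 8) (potential-[] n) (Staller-≤ n (suc n) [])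

-- Staller opens at an end vertex, which dominates two vertices.
ιg′-lower : ∀ m j → j ≤ 2 + m → 8 * j ≤ weight m → suc j ≤ ιg′ (P (2 + m))
ιg′-lower m j small le = reply (cut-end (2 + m) m (start (2 + m)))
  where
  open Game (P (2 + m))
  reply : Move (2 + m) [] (weight m + 0) → suc j ≤ ιg′ (P (2 + m))
  reply (move y p r) = GameProperties.Staller-lower (P (2 + m)) (2 + m) [] y p
    (Dominator-≥ (2 + m) (2 + m) (y ∷ []) j small (≤-trans le (≤-reflexive (trans (sym (+-identityʳ (weight m))) (sym r)))))

-- Evaluation of the formulas

/-unique : ∀ d .{{_ : NonZero d}} {a k} → d * k ≤ a → a < d * suc k → a / d ≡ k
/-unique d {a} {k} lo hi =
  ≤-antisym (s≤s⁻¹ (m<n*o⇒m/o<n (subst (a <_) (*-comm d (suc k)) hi))) (*-≤⇒≤-/ d lo)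

weight-5q+ : ∀ r q → weight (suc r + q * 5) ≡ q * 16 + weight (suc r)
weight-5q+ r zero = cong weight (+-identityʳ (suc r))
weight-5q+ r (suc q) = trans (cong weight (shift r (q * 5)))
  (trans (cong (16 +_) (weight-5q+ r q)) (sym (+-assoc 16 (q * 16) _)))
  where
  shift : ∀ r s → suc r + (5 + s) ≡ 6 + (r + s)
  shift = solve-∀

-- A weight of 14 or 15 above `q * 16` gives `1 + q * 2` when divided by 8 and rounded down, and
-- `2 + q * 2` rounded up. `rest` concerns the run left after Staller opens at an end vertex, and
-- `small` provides the fuel.
values : ∀ m q → 14 + q * 16 ≤ weight (2 + m) → weight (2 + m) ≤ 15 + q * 16 → 8 + q * 16 ≤ weight m →
  1 + q * 2 ≤ 2 + m → ιg (P (2 + m)) ≡ 1 + q * 2 × ιg′ (P (2 + m)) ≡ 2 + q * 2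
values m q lo hi rest small =
  ≤-antisym
    (≤-trans (ιg-upper (2 + m)) (≤-reflexive (/-unique 8 8j≤w
      (≤-trans (s≤s hi) (≤-reflexive (eight₂ q))))))
    (ιg-lower (2 + m) (1 + q * 2) (m≤n⇒m≤1+n small) 8j≤w) ,
  ≤-antisym
    (≤-trans (ιg′-upper (2 + m)) (≤-reflexive (/-unique 8
      (≤-trans (≤-reflexive (sym (eight₂ q))) (≤-trans (+-monoˡ-≤ (q * 16) (m≤m+n 16 5)) (+-monoʳ-≤ 7 lo)))
      (≤-trans (s≤s (+-monoʳ-≤ 7 hi)) (≤-trans (+-monoˡ-≤ (q * 16) (m≤m+n 23 1)) (≤-reflexive (eight₃ q)))))))
    (ιg′-lower m (1 + q * 2) small (≤-trans (≤-reflexive (eight₁ q)) rest))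
  where
  eight₁ : ∀ q → 8 * (1 + q * 2) ≡ 8 + q * 16
  eight₁ = solve-∀
  eight₂ : ∀ q → 16 + q * 16 ≡ 8 * (2 + q * 2)
  eight₂ = solve-∀
  eight₃ : ∀ q → 24 + q * 16 ≡ 8 * (3 + q * 2)
  eight₃ = solve-∀
  8j≤w : 8 * (1 + q * 2) ≤ weight (2 + m)
  8j≤w = ≤-trans (≤-reflexive (eight₁ q)) (≤-trans (+-monoˡ-≤ (q * 16) (m≤m+n 8 6)) lo)

-- Multiples of 5 are taken with `r = 5` and not `r = 0`, because `weight` is periodic only from
-- length 1 on.
values-at : ∀ r q → r ≡ 4 ⊎ r ≡ 5 → ιg (P (r + q * 5)) ≡ 1 + q * 2 × ιg′ (P (r + q * 5)) ≡ 2 + q * 2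
values-at .4 q (inj₁ refl) = values (2 + q * 5) q (≤-reflexive (sym w)) (≤-trans (≤-reflexive w) (n≤1+n _))
  (≤-reflexive (trans (+-comm 8 (q * 16)) (sym (weight-5q+ 1 q)))) (+-mono-≤ {1} {4} (m≤m+n 1 3) (*-monoʳ-≤ q (m≤m+n 2 3)))
  where
  w : weight (4 + q * 5) ≡ 14 + q * 16
  w = trans (weight-5q+ 3 q) (+-comm (q * 16) 14)
values-at .5 q (inj₂ refl) = values (3 + q * 5) q (≤-trans (n≤1+n _) (≤-reflexive (sym w))) (≤-reflexive w)
  (≤-trans (+-monoˡ-≤ (q * 16) (m≤m+n 8 4)) (≤-reflexive (trans (+-comm 12 (q * 16)) (sym (weight-5q+ 2 q)))))
  (+-mono-≤ {1} {5} (m≤m+n 1 4) (*-monoʳ-≤ q (m≤m+n 2 3)))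
  where
  w : weight (5 + q * 5) ≡ 15 + q * 16
  w = trans (weight-5q+ 4 q) (+-comm (q * 16) 15)

[s+d*k]/d≡k : ∀ d .{{_ : NonZero d}} s k → s < d → (s + d * k) / d ≡ k
[s+d*k]/d≡k d s k s<d = /-unique d (m≤n+m (d * k) s)
  (subst (s + d * k <_) (sym (*-suc d k)) (+-monoˡ-< (d * k) s<d))

-- `(2 * n + 4) / 5` is the ceiling of 2n/5. Each numerator is 5 times `2 + q * 2` plus a remainder
-- below 5.
formulas-at : ∀ r q → r ≡ 4 ⊎ r ≡ 5 →
  (2 * (r + q * 5) + 4) / 5 ≡ 2 + q * 2 × (2 * (r + q * 5) + 2) / 5 ≡ 2 + q * 2
formulas-at .4 q (inj₁ refl) =
  trans (cong (_/ 5) (e₁ q)) ([s+d*k]/d≡k 5 2 (2 + q * 2) (m≤m+n 3 2)) ,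
  trans (cong (_/ 5) (e₂ q)) ([s+d*k]/d≡k 5 0 (2 + q * 2) (m≤m+n 1 4))
  where
  e₁ : ∀ q → 2 * (4 + q * 5) + 4 ≡ 2 + 5 * (2 + q * 2)
  e₁ = solve-∀
  e₂ : ∀ q → 2 * (4 + q * 5) + 2 ≡ 0 + 5 * (2 + q * 2)
  e₂ = solve-∀
formulas-at .5 q (inj₂ refl) =
  trans (cong (_/ 5) (e₁ q)) ([s+d*k]/d≡k 5 4 (2 + q * 2) (m≤m+n 5 0)) ,
  trans (cong (_/ 5) (e₂ q)) ([s+d*k]/d≡k 5 2 (2 + q * 2) (m≤m+n 3 2))
  where
  e₁ : ∀ q → 2 * (5 + q * 5) + 4 ≡ 4 + 5 * (2 + q * 2)
  e₁ = solve-∀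
  e₂ : ∀ q → 2 * (5 + q * 5) + 2 ≡ 2 + 5 * (2 + q * 2)
  e₂ = solve-∀

Formulas : ℕ → Set
Formulas n = (ιg (P n) ≡ (2 * n + 4) / 5 ∸ 1) × (ιg′ (P n) ≡ (2 * n + 2) / 5)

formulas : ∀ r q → r ≡ 4 ⊎ r ≡ 5 → Formulas (r + q * 5)
formulas r q h =
  let v , v′ = values-at r q h
      f , f′ = formulas-at r q h
  in trans v (sym (cong (_∸ 1) f)) , trans v′ (sym f′)

theorem2p4 : (n : ℕ) → 6 ≤ n → (n % 5 ≡ 0 ⊎ n % 5 ≡ 4) →
    (ιg (P n) ≡ (2 * n + 4) / 5 ∸ 1) × (ιg′ (P n) ≡ (2 * n + 2) / 5)
theorem2p4 n 6≤n (inj₂ r≡4) = subst Formulas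
  (sym (trans (m≡m%n+[m/n]*n n 5) (cong (_+ n / 5 * 5) r≡4))) (formulas 4 (n / 5) (inj₁ refl))
theorem2p4 n 6≤n (inj₁ r≡0) = positive (n / 5) (trans (m≡m%n+[m/n]*n n 5) (cong (_+ n / 5 * 5) r≡0))
  where
  positive : ∀ q → n ≡ q * 5 → Formulas n
  -- Quotient 0 would mean `n = 0`; otherwise one 5 is split off to reach the form `5 + q * 5`.
  positive zero e = contradiction (subst (6 ≤_) e 6≤n) λ ()
  positive (suc q) e = subst Formulas (sym e) (formulas 5 q (inj₂ refl))
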